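{- Let $(\Sigma,A)$ be a $\mathfrak{Small}$-ary algebra whose underlying set $A$ is small. Then the $\mathfrak{Small}$-ary double centralizer $(\Sigma^A)^{\perp\perp(\mathfrak{Small})}$ is the set of all $\mathfrak{Small}$-ary operations $f:A^X \rightarrow A$ such that $h(f) = f(h \circ u_X)$ for every $\Sigma$-homomorphism $h:A^{(A^X)} \rightarrow A$, where $u_X:X\to A^{(A^X)}$ is the map that sends each $x\in X$ to the projection $\pi_x:A^X\to A$.
   Context: Fix a Grothendieck universe $\mathfrak{Small}$, i.e. the set of all sets of rank less than a fixed inaccessible cardinal; its elements are called small sets. Given a set $A$, a $\mathfrak{Small}$-ary operation on $A$ is a map $A^X \to A$ with $X$ a small set (its arity); nullary operations are allowed. A $\mathfrak{Small}$-ary signature is a (possibly large) set $\Sigma$ with an assignment of a small set, its arity, to each $\sigma\in\Sigma$. A $\Sigma$-algebra is a set $A$ equipped with an operation $\sigma^A:A^X\to A$ for each $\sigma\in\Sigma$, where $X$ is the arity of $\sigma$; a $\Sigma$-homomorphism is a map preserving these basic operations. A $\mathfrak{Small}$-ary algebra is a pair $(\Sigma,A)$ of a $\mathfrak{Small}$-ary signature $\Sigma$ and a $\Sigma$-algebra $A$; write $\Sigma^A=\{\sigma^A\mid\sigma\in\Sigma\}$. Each power $A^Y$ is a $\Sigma$-algebra under the pointwise operations; in particular $A^{(A^X)}$ is a $\Sigma$-algebra. Operations $f:A^X\to A$ and $g:A^Y\to A$ commute, written $f\perp g$, if for every matrix $a=(a_{xy})\in A^{X\times Y}$ one has $g\bigl((f((a_{xy})_{x\in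 X}))_{y\in Y}\bigr)=f\bigl((g((a_{xy})_{y\in Y}))_{x\in X}\bigr)$. For a set $G$ of $\mathfrak{Small}$-ary operations on $A$, $G^{\perp(\mathfrak{Small})}$ is the set of all $\mathfrak{Small}$-ary operations $f$ on $A$ with $f\perp g$ for all $g\in G$, and $G^{\perp\perp(\mathfrak{Small})}$ is the result of applying $(-)^{\perp(\mathfrak{Small})}$ twice to $G$. In $h(f)$, the map $f:A^X\to A$ is regarded as an element of $A^{(A^X)}$; and $h\circ u_X:X\to A$ is regarded as an element of $A^X$. -}

module Defs where

-- Sets are rendered as types and maps as functions.  The universe of small
-- sets is Set ℓ for an arbitrary level ℓ; a possibly large set is a type at
-- some unrelated level.  Function extensionality is not assumed: commutation of
-- operations only asserts equalities between elements of the carrier.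

open import Level using (Level; _⊔_) renaming (suc to lsuc)
open import Data.Product using (_×_; _,_; Σ; ∃)
open import Function using (_∘_)
open import Relation.Binary.PropositionalEquality using (_≡_)
open import Relation.Unary using (Pred; _∈_)

private
  variable
    ℓ s a x y p : Level

-- An operation carries its arity, so that a set of operations may contain
-- operations of different arities.
Operation : (ℓ : Level) → Set a → Set (lsuc ℓ ⊔ a)
Operation ℓ A = Σ (Set ℓ) λ X → (X → A) → A

infix 4 _⊥_
_⊥_ : {A : Set a} {X : Set x} {Y : Set y} →
      ((X → A) → A) → ((Y → A) → A) → Set (a ⊔ x ⊔ y)
_⊥_ {A = A} {X = X} {Y = Y} f g =
  (m : X × Y → A) →
  g (λ y → f (λ x → m (x , y))) ≡ f (λ x → g (λ y → m (x , y)))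

infix 10 _^⊥ _^⊥⊥
_^⊥ : {A : Set a} → Pred (Operation ℓ A) p →
      Pred (Operation ℓ A) (lsuc ℓ ⊔ a ⊔ p)
_^⊥ {ℓ = ℓ} {A = A} G (X , f) =
  (Y : Set ℓ) (g : (Y → A) → A) → (Y , g) ∈ G → f ⊥ g

_^⊥⊥ : {A : Set a} → Pred (Operation ℓ A) p →
       Pred (Operation ℓ A) (lsuc ℓ ⊔ a ⊔ p)
G ^⊥⊥ = (G ^⊥) ^⊥

record Signature (ℓ s : Level) : Set (lsuc (ℓ ⊔ s)) where
  field
    Symbol : Set s
    arity  : Symbol → Set ℓ

open Signature public

record Algebra (S : Signature ℓ s) (a : Level) : Set (ℓ ⊔ s ⊔ lsuc a) where
  field
    Carrier : Set a
    ⟦_⟧     : (σ : Symbol S) → (arity S σ → Carrier) → Carrier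

open Algebra public using (Carrier)

basicOperations : {S : Signature ℓ s} (A : Algebra S a) →
                  Pred (Operation ℓ (Carrier A)) (lsuc ℓ ⊔ s ⊔ a)
basicOperations {S = S} A f = ∃ λ σ → f ≡ (arity S σ , ⟦ σ ⟧)
  where open Algebra A

infixr 8 _^_
_^_ : {S : Signature ℓ s} → Algebra S a → (Y : Set y) → Algebra S (a ⊔ y)
A ^ Y = record
  { Carrier = Y → Carrier A
  ; ⟦_⟧     = λ σ t y → ⟦ σ ⟧ (λ i → t i y)
  }
  where open Algebra A

record Homomorphism {S : Signature ℓ s} (A : Algebra S a) (B : Algebra S y) :
                    Set (ℓ ⊔ s ⊔ a ⊔ y) where
  private
    module A = Algebra A
    module B = Algebra B
  field
    map       : A.Carrier → B.Carrier
    preserves : (σ : Symbol S) (t : arity S σ → A.Carrier) →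
                map (A.⟦ σ ⟧ t) ≡ B.⟦ σ ⟧ (map ∘ t)

open Homomorphism public using (map)

u : (A : Set a) (X : Set x) → X → ((X → A) → A)
u A X x = λ t → t x

{-# OPTIONS --safe #-}

-- A homomorphism A ^ (X → A) → A is exactly an operation of arity X → A that
-- commutes with the basic operations.  If f is in the double centralizer, it
-- commutes with such an h, and evaluating this at the matrix (x , t) ↦ t x gives
-- the condition.  Conversely, an operation g in the centralizer and a matrix m
-- yield the homomorphism k ↦ g (y ↦ k (m (- , y))), at which the condition says
-- that f and g commute on m.

module Submission where

open import Defs
open import Level using (Level)
open import Data.Product using (_×_; _,_)
open import Function using (_∘_)
open import Relation.Binary.PropositionalEquality using (_≡_; refl; sym)
open import Relation.Unary using (_∈_; _≐_)

module _ {ℓ s : Level} {S : Signature ℓ s} (A : Algebra S ℓ) where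

  open Algebra A using (⟦_⟧)

  homomorphism∈centralizer : {Y : Set ℓ} (h : Homomorphism (A ^ Y) A) →
    (Y , map h) ∈ basicOperations A ^⊥
  homomorphism∈centralizer h _ _ (σ , refl) m =
    sym (Homomorphism.preserves h σ (λ i y → m (y , i)))

  -- The map is a composite of homomorphisms: evaluation at the columns of `m`, from
  -- `A ^ (X → Carrier A)` to `A ^ Y`, followed by `g`.
  centralizerHomomorphism : {X Y : Set ℓ} (g : (Y → Carrier A) → Carrier A) →
    (Y , g) ∈ basicOperations A ^⊥ → (X × Y → Carrier A) →
    Homomorphism (A ^ (X → Carrier A)) A
  centralizerHomomorphism g g∈ m = record
    { map       = λ k → g (λ y → k (λ x → m (x , y)))
    ; preserves = λ σ t →
        sym (g∈ (arity S σ) ⟦ σ ⟧ (σ , refl) (λ (y , i) → t i (λ x → m (x , y))))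
    }

corollary6p3 : {ℓ s : Level} (S : Signature ℓ s) (A : Algebra S ℓ) →
    (basicOperations A) ^⊥⊥ ≐
    (λ (X , f) → (h : Homomorphism (A ^ (X → Carrier A)) A) →
    map h f ≡ f (map h ∘ u (Carrier A) X))
corollary6p3 S A =
  (λ {(X , f)} f∈ h →
    -- Column `t` of this matrix is `t` itself and row `x` is `u (Carrier A) X x`, so commutation is
    -- the goal up to eta.
    f∈ (X → Carrier A) (map h) (homomorphism∈centralizer A h) (λ (x , t) → t x)) ,
  -- This homomorphism sends `u (Carrier A) X x` to `g` of row `x` of `m`, and `f` to `g` of the
  -- values of `f` on the columns.
  (λ f-cond Y g g∈ m → f-cond (centralizerHomomorphism A g g∈ m))
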